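{- Every scattered polynomial $h(x)\in\mathbb{F}_{q^n}[x]$ in standard form is bijective as a map $\mathbb{F}_{q^n}\to\mathbb{F}_{q^n}$.
   Context: $q$ is a prime power, $n>1$. A $q$-polynomial $h(x)=\sum_{i=0}^{n-1}b_ix^{q^i}\in\mathbb{F}_{q^n}[x]$ is scattered if for all $y,z\in\mathbb{F}_{q^n}$, $zh(y)-yh(z)=0$ implies $y,z$ are $\mathbb{F}_q$-linearly dependent. Let $\Delta_h=\{(i-j)\bmod n\colon b_ib_j\neq0,\ i\neq j\}\cup\{n\}$ and $t_h=\gcd(\Delta_h)$; $h$ is in standard form if $t_h>1$. -}

module Defs where

open import Level using (Level; _⊔_) renaming (suc to lsuc)
open import Algebra.Bundles using (CommutativeRing; Semiring)
open import Algebra.Apartness.Bundles using (HeytingField; HeytingCommutativeRing)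
open import Algebra.Morphism.Bundles using (RingHomomorphism)
import Algebra.Definitions.RawSemiring as RawSemiringDefs
open import Data.Fin.Base using (Fin; toℕ)
import Data.Fin.Properties as Fin
open import Data.Integer.Base using (+_; _-_; _%ℕ_)
open import Data.List.Base using (List; _∷_; map; filter; foldr; allFin; cartesianProduct)
open import Data.Nat.Base using (ℕ; _^_; _≤_; _<_)
open import Data.Nat.GCD using (gcd)
open import Data.Nat.Primality using (Prime)
open import Data.Product.Base using (_×_; _,_; ∃-syntax)
open import Data.Vec.Functional using (Vector)
open import Function.Bundles using (Inverse)
open import Function.Properties.Inverse using (Inverse⇒Injection)
open import Relation.Binary.Definitions using (Decidable)
open import Relation.Binary.PropositionalEquality as ≡ using (_≡_; _≢_)
open import Relation.Nullary using (¬_; Dec; ¬?; _×-dec_)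
open import Relation.Nullary.Decidable using (via-injection)

IsPrimePower : ℕ → Set
IsPrimePower q = ∃[ p ] ∃[ k ] (Prime p × 1 ≤ k × q ≡ p ^ k)

-- A field with exactly m elements up to _≈_.  The enumeration makes _≈_, and
-- hence invertibility, decidable; so the apartness of the Heyting field is just
-- _≉_, and every element _≉_ 0# is invertible, as in a classical field.
record FiniteField (c ℓ₁ ℓ₂ : Level) (m : ℕ) : Set (lsuc (c ⊔ ℓ₁ ⊔ ℓ₂)) where
  field
    heytingField : HeytingField c ℓ₁ ℓ₂

  commutativeRing : CommutativeRing c ℓ₁
  commutativeRing =
    HeytingCommutativeRing.commutativeRing (HeytingField.heytingCommutativeRing heytingField)

  open CommutativeRing commutativeRing public

  field
    enumeration : Inverse setoid (≡.setoid (Fin m))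

  _≟_ : Decidable _≈_
  _≟_ = via-injection (Inverse⇒Injection enumeration) Fin._≟_

-- The q-polynomial Σ_{i<n} bᵢ x^(q^i) is represented by its coefficient vector b.
module QPolynomial
  {c ℓ₁ ℓ₂ : Level} (q n : ℕ) (E : FiniteField c ℓ₁ ℓ₂ (q ^ n))
  (b : Vector (FiniteField.Carrier E) n)
  where

  open FiniteField E using (Carrier; _≈_; _≉_; _≟_; _*_; 0#; semiring)
  open RawSemiringDefs (Semiring.rawSemiring semiring) using (sum) renaming (_^_ to _^ᴱ_)

  eval : Carrier → Carrier
  eval x = sum (λ i → b i * (x ^ᴱ (q ^ toℕ i)))

  ContributesToΔ : Fin n × Fin n → Set ℓ₁
  ContributesToΔ (i , j) = (b i * b j ≉ 0#) × (i ≢ j)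

  contributesToΔ? : ∀ ij → Dec (ContributesToΔ ij)
  contributesToΔ? (i , j) = ¬? ((b i * b j) ≟ 0#) ×-dec ¬? (i Fin.≟ j)

  differenceMod : Fin n × Fin n → ℕ
  differenceMod (i , j) = _%ℕ_ (+ toℕ i - + toℕ j) n {{Fin.nonZeroIndex i}}

  -- The set Δ_h as a list; repetitions do not affect the gcd.
  Δ : List ℕ
  Δ = n ∷ map differenceMod (filter contributesToΔ? (cartesianProduct (allFin n) (allFin n)))

  t : ℕ
  t = foldr gcd 0 Δ

  InStandardForm : Set
  InStandardForm = 1 < t

-- F = F_q, E = F_{q^n}, and ι (automatically injective) exhibits E as an
-- extension of F, necessarily of degree n.
module Extension
  {c ℓ₁ ℓ₂ c′ ℓ₁′ ℓ₂′ : Level} (q n : ℕ)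
  (F : FiniteField c ℓ₁ ℓ₂ q) (E : FiniteField c′ ℓ₁′ ℓ₂′ (q ^ n))
  (ι : RingHomomorphism (FiniteField.rawRing F) (FiniteField.rawRing E))
  where

  private
    module F = FiniteField F
    module E = FiniteField E
  open RingHomomorphism ι using (⟦_⟧)

  LinearlyDependent : E.Carrier → E.Carrier → Set (c ⊔ ℓ₁ ⊔ ℓ₁′)
  LinearlyDependent y z =
    ∃[ α ] ∃[ β ] (¬ ((α F.≈ F.0#) × (β F.≈ F.0#))
                  × (⟦ α ⟧ E.* y) E.+ (⟦ β ⟧ E.* z) E.≈ E.0#)

  IsScattered : Vector E.Carrier n → Set (c ⊔ ℓ₁ ⊔ c′ ⊔ ℓ₁′)
  IsScattered b = ∀ y z → (z E.* h y) E.- (y E.* h z) E.≈ E.0# → LinearlyDependent y z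
    where
    h : E.Carrier → E.Carrier
    h = QPolynomial.eval q n E b

{-# OPTIONS --safe #-}
module Submission where

-- If t = t_h, then all exponents i with bᵢ ≠ 0 are congruent mod t, so h (a x) = μ h x whenever
-- a^(q^t) = a.  If h x = 0 with x ≠ 0, then x and a x are both zeros of h, hence F_q-linearly
-- dependent because h is scattered, which forces a ∈ F_q, i.e. a^q = a.  But the q^t-th power map
-- on F_{q^n} has a fixed point outside F_q as t > 1.  So h, being additive, is injective, and an
-- injective self-map of a finite set is bijective.

open import Defs
open import Level using (Level)
open import Algebra.Apartness.Bundles using (HeytingField)
open import Algebra.Bundles using (CommutativeRing; CommutativeSemiring; Semiring)
open import Algebra.Morphism.Bundles using (RingHomomorphism)
import Algebra.Apartness.Properties.HeytingCommutativeRing as HeytingProperties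
import Algebra.Properties.CommutativeMonoid.Sum as CommutativeMonoidSum
import Algebra.Properties.CommutativeSemigroup as CommutativeSemigroupProperties
import Algebra.Properties.CommutativeSemiring.Binomial as BinomialTheorem
import Algebra.Properties.CommutativeSemiring.Exp as CommutativeSemiringExp
import Algebra.Properties.Ring as RingProperties
import Algebra.Properties.Semiring.Exp as SemiringExp
import Algebra.Properties.Semiring.Mult as SemiringMult
import Algebra.Properties.Semiring.Sum as SemiringSum
open import Data.Empty using (⊥-elim)
open import Data.Fin.Base using (Fin; zero; suc; toℕ; fromℕ; punchOut)
open import Data.Fin.Permutation using (Permutation′; permutation)
import Data.Fin.Properties as Fin
import Data.Integer.Base as ℤ
import Data.Integer.DivMod as ℤ
import Data.Integer.Divisibility.Signed as ℤ
import Data.Integer.Properties as ℤ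
open import Data.List.Base using (List; _∷_; foldr)
open import Data.List.Membership.Propositional using (_∈_)
open import Data.List.Membership.Propositional.Properties
  using (∈-allFin; ∈-cartesianProduct⁺; ∈-filter⁺; ∈-map⁺)
open import Data.List.Relation.Unary.Any using (here; there)
open import Data.Nat.Base
  using (ℕ; zero; suc; _^_; _≤_; _<_; z≤n; s≤s; NonZero; >-nonZero; nonTrivial⇒n>1)
import Data.Nat.Base as ℕ
open import Data.Nat.Combinatorics using (_C_; nCn≡1; nCk≡n!/k![n-k]!; k![n∸k]!∣n!)
open import Data.Nat.Divisibility
open import Data.Nat.DivMod using (m/n*n≡m)
open import Data.Nat.GCD using (gcd; gcd[m,n]∣m; gcd[m,n]∣n)
open import Data.Nat.Primality using (Prime; euclidsLemma; prime⇒nonZero; prime⇒nonTrivial)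
import Data.Nat.Properties as ℕ
open import Data.Product.Base using (_×_; _,_; proj₁; proj₂; ∃-syntax)
open import Data.Sum.Base using (_⊎_; inj₁; inj₂)
open import Data.Vec.Base using (Vec; []; _∷_; replicate)
open import Data.Vec.Functional using (Vector; removeAt; tail; init)
open import Function.Base using (_∘_)
open import Function.Bundles using (module Inverse)
open import Function.Definitions using (Bijective; Congruent; Injective)
open import Relation.Binary.PropositionalEquality as ≡ using (_≡_; _≢_; cong; subst)
import Relation.Binary.Reasoning.Setoid as SetoidReasoning
open import Relation.Nullary using (¬_; yes; no; ¬?; contradiction)
open import Relation.Nullary.Decidable using (decidable-stable)

-- Divisibility, binomial coefficients modulo a prime, geometric sums, pigeonhole

module Arithmetic where
  open import Data.Nat.Base using (_+_; _*_; _∸_; _!)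
  open import Data.Nat.Properties

  foldr-gcd∣ : ∀ {x} {xs : List ℕ} → x ∈ xs → foldr gcd 0 xs ∣ x
  foldr-gcd∣ {xs = y ∷ ys} (here ≡.refl)  = gcd[m,n]∣m y (foldr gcd 0 ys)
  foldr-gcd∣ {xs = y ∷ ys} (there x∈ys) =
    ∣-trans (gcd[m,n]∣n y (foldr gcd 0 ys)) (foldr-gcd∣ x∈ys)

  -- Since `i - j` is its remainder plus a multiple of `n`, divisibility by `t` passes from the
  -- remainder to `i - j`. The two cases record which number is larger, so that the multiplier is a
  -- natural number and can serve in an exponent.
  ∣%ℕ⇒congruent : ∀ {t} i j n .{{_ : NonZero n}} → t ∣ n → t ∣ (ℤ.+ i ℤ.- ℤ.+ j) ℤ.%ℕ n →
                  (∃[ k ] i ≡ k * t + j) ⊎ (∃[ k ] j ≡ k * t + i)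
  ∣%ℕ⇒congruent {t} i j n t∣n t∣r = byOrder (≤-total j i)
    where
    d = ℤ.+ i ℤ.- ℤ.+ j

    t∣d : ℤ.+ t ℤ.∣ d
    t∣d = subst (ℤ.+ t ℤ.∣_) (≡.sym (ℤ.a≡a%ℕn+[a/ℕn]*n d n))
            (ℤ.∣m∣n⇒∣m+n (ℤ.∣ᵤ⇒∣ {i = ℤ.+ (d ℤ.%ℕ n)} t∣r)
                         (ℤ.∣n⇒∣m*n (d ℤ./ℕ n) (ℤ.∣ᵤ⇒∣ {i = ℤ.+ n} t∣n)))

    t∣∣i⊖j∣ : t ∣ ℤ.∣ i ℤ.⊖ j ∣
    t∣∣i⊖j∣ = subst (λ e → t ∣ ℤ.∣ e ∣) (ℤ.m-n≡m⊖n i j) (ℤ.∣⇒∣ᵤ t∣d)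

    multiple : ∀ {a b} → b ≤ a → t ∣ a ∸ b → ∃[ k ] a ≡ k * t + b
    multiple {b = b} b≤a (divides k a∸b≡kt) =
      k , ≡.trans (≡.sym (m∸n+n≡m b≤a)) (cong (_+ b) a∸b≡kt)

    byOrder : j ≤ i ⊎ i ≤ j → _
    byOrder (inj₁ j≤i) = inj₁ (multiple j≤i
      (subst (t ∣_) (≡.trans (ℤ.∣m⊖n∣≡∣n⊖m∣ i j) (ℤ.∣⊖∣-≤ j≤i)) t∣∣i⊖j∣))
    byOrder (inj₂ i≤j) = inj₂ (multiple i≤j (subst (t ∣_) (ℤ.∣⊖∣-≤ i≤j) t∣∣i⊖j∣))

  prime∤! : ∀ {p} → Prime p → ∀ k → k < p → p ∤ k !
  prime∤! pr zero    k<p p∣1 = <⇒≢ (nonTrivial⇒n>1 _ {{prime⇒nonTrivial pr}}) (≡.sym (∣1⇒≡1 p∣1))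
  prime∤! pr (suc k) k<p p∣! with euclidsLemma (suc k) (k !) pr p∣!
  ... | inj₁ p∣1+k = >⇒∤ k<p p∣1+k
  ... | inj₂ p∣k!  = prime∤! pr k (<-trans (n<1+n k) k<p) p∣k!

  -- By Euclid's lemma: `p` divides `p !`, which is the binomial coefficient times two factorials of
  -- numbers below `p`, and it divides neither factorial.
  prime∣C : ∀ {p} → Prime p → ∀ k → 0 < k → k < p → p ∣ p C k
  prime∣C {p} pr k 0<k k<p with euclidsLemma (p C k) (k ! * (p ∸ k) !) pr p∣pCk*k![p∸k]!
    where
    instance
      _ = k !* (p ∸ k) !≢0
      _ = prime⇒nonZero pr
    pCk*k![p∸k]!≡p! : (p C k) * (k ! * (p ∸ k) !) ≡ p !
    pCk*k![p∸k]!≡p! = ≡.trans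
      (cong (_* (k ! * (p ∸ k) !)) (nCk≡n!/k![n-k]! (<⇒≤ k<p)))
      (m/n*n≡m (k![n∸k]!∣n! (<⇒≤ k<p)))
    n∣n! : ∀ n → .{{NonZero n}} → n ∣ n !
    n∣n! (suc n) = m∣m*n (n !)
    p∣pCk*k![p∸k]! : p ∣ (p C k) * (k ! * (p ∸ k) !)
    p∣pCk*k![p∸k]! = subst (p ∣_) (≡.sym pCk*k![p∸k]!≡p!) (n∣n! p)
  ... | inj₁ p∣pCk = p∣pCk
  ... | inj₂ p∣k![p∸k]! with euclidsLemma (k !) ((p ∸ k) !) pr p∣k![p∸k]!
  ...   | inj₁ p∣k!     = contradiction p∣k! (prime∤! pr k k<p)
  ...   | inj₂ p∣[p∸k]! = contradiction p∣[p∸k]!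
            (prime∤! pr (p ∸ k) (∸-monoʳ-< 0<k (<⇒≤ k<p)))

  geometricSum : ℕ → ℕ → ℕ
  geometricSum r zero    = 0
  geometricSum r (suc k) = 1 + r * geometricSum r k

  -- (r - 1) (1 + r + ⋯ + r^(k-1)) = r^k - 1, with the subtractions moved across.
  geometricSum-closed : ∀ r k → r * geometricSum r k + 1 ≡ geometricSum r k + r ^ k
  geometricSum-closed r zero    = cong (_+ 1) (*-zeroʳ r)
  geometricSum-closed r (suc k) = begin
    r * (1 + r * g) + 1   ≡⟨ cong (λ e → r * e + 1) (+-comm 1 (r * g)) ⟩
    r * (r * g + 1) + 1   ≡⟨ cong (λ e → r * e + 1) (geometricSum-closed r k) ⟩
    r * (g + r ^ k) + 1   ≡⟨ cong (_+ 1) (*-distribˡ-+ r g (r ^ k)) ⟩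
    r * g + r ^ suc k + 1 ≡⟨ +-comm _ 1 ⟩
    1 + r * g + r ^ suc k ∎
    where
    open ≡.≡-Reasoning
    g = geometricSum r k

  -- Writing `g` for the geometric sum, `g * (r - 1) = r ^ k - 1` and `q < r - 1`. It later shows
  -- that the exponent `1 + g * q` is below the order of the field.
  1+geometricSum*q<r^k : ∀ {q r} k → suc q < r → .{{NonZero k}} →
                         suc (geometricSum r k * q) < r ^ k
  1+geometricSum*q<r^k {q} {r} k@(suc _) 1+q<r = +-cancelˡ-< g _ _ (begin-strict
    g + suc (g * q) ≡⟨ +-suc g (g * q) ⟩
    suc (g + g * q) ≡⟨ cong suc (*-suc g q) ⟨
    -- Strictness needs `g` nonzero: as `k` is matched as a successor, `g` reduces to a successor.
    suc (g * suc q) <⟨ s≤s (*-monoʳ-< g 1+q<r) ⟩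
    suc (g * r)     ≡⟨ cong suc (*-comm g r) ⟩
    suc (r * g)     ≡⟨ +-comm 1 (r * g) ⟩
    r * g + 1       ≡⟨ geometricSum-closed r k ⟩
    g + r ^ k       ∎)
    where
    open ≤-Reasoning
    g = geometricSum r k

  -- If `j` were missed, deleting it from the codomain would leave an injection into a smaller
  -- finite set.
  Fin-injective⇒surjective : ∀ {n} {f : Fin n → Fin n} → Injective _≡_ _≡_ f →
                             ∀ j → ∃[ i ] f i ≡ j
  Fin-injective⇒surjective {suc n} {f} f-inj j with Fin.any? (λ i → f i Fin.≟ j)
  ... | yes hit = hit
  ... | no miss = ⊥-elim
    (Fin.<⇒notInjective {f = λ i → punchOut (j≢f i)} (n<1+n n)
      (λ eq → f-inj (Fin.punchOut-injective (j≢f _) (j≢f _) eq)))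
    where
    j≢f : ∀ i → j ≢ f i
    j≢f i j≡fi = miss (i , ≡.sym j≡fi)

open Arithmetic

-- Iterated power maps

module Powers {c ℓ : Level} (S : Semiring c ℓ) where
  open Semiring S using (_≈_; trans; sym; *-identityʳ)
  open SemiringExp S public renaming (_^_ to _^ᴿ_)

  fixed-by-power : ∀ {x} r k → x ^ᴿ r ≈ x → x ^ᴿ (r ^ k) ≈ x
  fixed-by-power r zero    x^r≈x = *-identityʳ _
  fixed-by-power {x} r (suc k) x^r≈x = trans (sym (^-assocʳ x r (r ^ k)))
    (trans (^-congˡ (r ^ k) x^r≈x) (fixed-by-power r k x^r≈x))

  -- Applying the `q ^ t`-th power map `k` times leaves `x` unchanged, and then only the exponent
  -- `q ^ j` remains. So `x ^ (q ^ i)` depends only on `i` modulo `t`.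
  periodic : ∀ {x} q t k j → x ^ᴿ (q ^ t) ≈ x → x ^ᴿ (q ^ (k ℕ.* t ℕ.+ j)) ≈ x ^ᴿ (q ^ j)
  periodic {x} q t k j x^qᵗ≈x = begin
    x ^ᴿ (q ^ (k ℕ.* t ℕ.+ j))      ≡⟨ cong (x ^ᴿ_) (ℕ.^-distribˡ-+-* q (k ℕ.* t) j) ⟩
    x ^ᴿ (q ^ (k ℕ.* t) ℕ.* q ^ j)  ≡⟨ cong (λ e → x ^ᴿ (q ^ e ℕ.* q ^ j)) (ℕ.*-comm k t) ⟩
    x ^ᴿ (q ^ (t ℕ.* k) ℕ.* q ^ j)  ≡⟨ cong (λ e → x ^ᴿ (e ℕ.* q ^ j)) (ℕ.^-*-assoc q t k) ⟨
    x ^ᴿ ((q ^ t) ^ k ℕ.* q ^ j)    ≈⟨ ^-assocʳ x ((q ^ t) ^ k) (q ^ j) ⟨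
    (x ^ᴿ ((q ^ t) ^ k)) ^ᴿ (q ^ j) ≈⟨ ^-congˡ (q ^ j) (fixed-by-power (q ^ t) k x^qᵗ≈x) ⟩
    x ^ᴿ (q ^ j)                    ∎
    where open SetoidReasoning (Semiring.setoid S)

-- Additivity of the Frobenius map

module FrobeniusMap {c ℓ : Level} (S : CommutativeSemiring c ℓ) where
  open CommutativeSemiring S hiding (zero)
  open SemiringExp semiring using (^-assocʳ; ^-congˡ) renaming (_^_ to _^ᴿ_)
  open SemiringMult semiring using (×-assocˡ; ×-congʳ; ×-comm-*; ×-homo-1)
    renaming (_×_ to _×ᴿ_)
  open SemiringSum semiring using (sum; sum-init-last; sum-cong-≋; sum-replicate-zero)
  open SetoidReasoning setoid

  ×-annihilates : ∀ {p m} → p ×ᴿ 1# ≈ 0# → p ∣ m → ∀ x → m ×ᴿ x ≈ 0#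
  ×-annihilates {p} p×1≈0 (divides k ≡.refl) x = begin
    (k ℕ.* p) ×ᴿ x       ≡⟨ cong (_×ᴿ x) (ℕ.*-comm k p) ⟩
    (p ℕ.* k) ×ᴿ x       ≈⟨ ×-assocˡ x p k ⟨
    p ×ᴿ (k ×ᴿ x)        ≈⟨ ×-congʳ p (*-identityʳ _) ⟨
    p ×ᴿ ((k ×ᴿ x) * 1#) ≈⟨ ×-comm-* p (k ×ᴿ x) 1# ⟨
    (k ×ᴿ x) * (p ×ᴿ 1#) ≈⟨ *-congˡ p×1≈0 ⟩
    (k ×ᴿ x) * 0#        ≈⟨ zeroʳ _ ⟩
    0#                   ∎

  -- In the binomial expansion all inner coefficients are divisible by `p` and vanish. The term of
  -- index `k` carries `x ^ k`, so the first survivor is `y ^ p` and the last is `x ^ p`.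
  ^-prime-distrib-+ : ∀ {p} → Prime p → p ×ᴿ 1# ≈ 0# →
                      ∀ x y → (x + y) ^ᴿ p ≈ x ^ᴿ p + y ^ᴿ p
  ^-prime-distrib-+ {zero}  pr _ _ _ with () ← prime⇒nonZero pr
  ^-prime-distrib-+ {p@(suc p-1)} pr p×1≈0 x y = begin
    (x + y) ^ᴿ p                                    ≈⟨ BinomialTheorem.theorem S p x y ⟩
    term zero + sum (tail term)                     ≈⟨ +-congˡ (sum-init-last (tail term)) ⟩
    term zero + (sum (init (tail term)) + term top) ≈⟨ +-congˡ (+-congʳ middle) ⟩
    term zero + (0# + term top)                     ≈⟨ +-congˡ (+-identityˡ _) ⟩
    term zero + term top                            ≈⟨ +-cong first last ⟩
    y ^ᴿ p + x ^ᴿ p                                 ≈⟨ +-comm _ _ ⟩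
    x ^ᴿ p + y ^ᴿ p                                 ∎
    where
    term = BinomialTheorem.binomialTerm S x y p
    top = suc (fromℕ p-1)

    middle : sum (init (tail term)) ≈ 0#
    middle = trans (sum-cong-≋ vanish) (sum-replicate-zero p-1)
      where
      vanish : ∀ i → init (tail term) i ≈ 0#
      -- After `tail` and `init` the binomial index is `1 + toℕ i` with `toℕ i < p - 1`, hence
      -- strictly between 0 and `p`.
      vanish i = ×-annihilates p×1≈0
        (prime∣C pr _ (s≤s z≤n)
          (s≤s (ℕ.≤-trans (s≤s (ℕ.≤-reflexive (Fin.toℕ-inject₁ i))) (Fin.toℕ<n i)))) _

    first : term zero ≈ y ^ᴿ p
    first = trans (×-homo-1 _) (*-identityˡ _)

    last : term top ≈ x ^ᴿ p
    last = begin
      term top                             ≡⟨ cong (λ k → (p C k) ×ᴿ (x ^ᴿ k * y ^ᴿ (p ℕ.∸ k))) (cong suc (Fin.toℕ-fromℕ p-1)) ⟩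
      (p C p) ×ᴿ (x ^ᴿ p * y ^ᴿ (p ℕ.∸ p)) ≡⟨ cong (λ k → (p C p) ×ᴿ (x ^ᴿ p * y ^ᴿ k)) (ℕ.n∸n≡0 p) ⟩
      (p C p) ×ᴿ (x ^ᴿ p * 1#)             ≡⟨ cong (_×ᴿ (x ^ᴿ p * 1#)) (nCn≡1 p) ⟩
      1 ×ᴿ (x ^ᴿ p * 1#)                   ≈⟨ ×-homo-1 _ ⟩
      x ^ᴿ p * 1#                          ≈⟨ *-identityʳ _ ⟩
      x ^ᴿ p                               ∎

  ^-primePower-distrib-+ : ∀ {p} → Prime p → p ×ᴿ 1# ≈ 0# → ∀ k x y →
                           (x + y) ^ᴿ (p ^ k) ≈ x ^ᴿ (p ^ k) + y ^ᴿ (p ^ k)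
  ^-primePower-distrib-+ pr p×1≈0 zero x y =
    trans (*-identityʳ _) (sym (+-cong (*-identityʳ _) (*-identityʳ _)))
  ^-primePower-distrib-+ {p} pr p×1≈0 (suc k) x y = begin
    (x + y) ^ᴿ (p ℕ.* p ^ k)                  ≈⟨ ^-assocʳ _ p (p ^ k) ⟨
    ((x + y) ^ᴿ p) ^ᴿ (p ^ k)                 ≈⟨ ^-congˡ (p ^ k) (^-prime-distrib-+ pr p×1≈0 x y) ⟩
    (x ^ᴿ p + y ^ᴿ p) ^ᴿ (p ^ k)              ≈⟨ ^-primePower-distrib-+ pr p×1≈0 k _ _ ⟩
    (x ^ᴿ p) ^ᴿ (p ^ k) + (y ^ᴿ p) ^ᴿ (p ^ k) ≈⟨ +-cong (^-assocʳ x p (p ^ k)) (^-assocʳ y p (p ^ k)) ⟩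
    x ^ᴿ (p ℕ.* p ^ k) + y ^ᴿ (p ℕ.* p ^ k)   ∎

-- Monic polynomials and the number of their roots

module MonicPolynomial {c ℓ : Level} (R : CommutativeRing c ℓ) where
  open CommutativeRing R hiding (zero)
  open RingProperties ring using (x∙y⁻¹≈ε⇒x≈y; //-rightDividesˡ; -1*x≈-x)
  open SemiringExp semiring using () renaming (_^_ to _^ᴿ_)
  open SetoidReasoning setoid

  -- c₀ ∷ ⋯ ∷ c_{d-1} stands for c₀ + c₁ x + ⋯ + c_{d-1} x^(d-1) + x^d.
  ⟦_⟧ : ∀ {d} → Vec Carrier d → Carrier → Carrier
  ⟦ [] ⟧      x = 1#
  ⟦ c₀ ∷ cs ⟧ x = c₀ + x * ⟦ cs ⟧ x

  -- Synthetic division by `x - a`: the coefficients of the quotient are the intermediate values of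
  -- Horner's scheme at `a`, and the leading 1 stays implicit.
  quotientAt : ∀ {d} → Carrier → Vec Carrier (suc d) → Vec Carrier d
  quotientAt {zero}  a _        = []
  quotientAt {suc d} a (_ ∷ cs) = ⟦ cs ⟧ a ∷ quotientAt a cs

  a+[x-a]≈x : ∀ a x → a + (x - a) ≈ x
  a+[x-a]≈x a x = trans (+-comm _ _) (//-rightDividesˡ a x)

  factorTheorem : ∀ {d} a (cs : Vec Carrier (suc d)) x →
                  ⟦ cs ⟧ x ≈ ⟦ cs ⟧ a + (x - a) * ⟦ quotientAt a cs ⟧ x
  factorTheorem a (c₀ ∷ []) x = begin
    c₀ + x * 1#                  ≈⟨ +-congˡ (*-congʳ (a+[x-a]≈x a x)) ⟨
    c₀ + (a + (x - a)) * 1#      ≈⟨ +-congˡ (distribʳ 1# a (x - a)) ⟩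
    c₀ + (a * 1# + (x - a) * 1#) ≈⟨ +-assoc _ _ _ ⟨
    c₀ + a * 1# + (x - a) * 1#   ∎
  factorTheorem a (c₀ ∷ cs@(_ ∷ _)) x = begin
    c₀ + x * ⟦ cs ⟧ x                    ≈⟨ +-congˡ (*-congˡ (factorTheorem a cs x)) ⟩
    c₀ + x * (g + δ * h)                 ≈⟨ +-congˡ (distribˡ x g (δ * h)) ⟩
    c₀ + (x * g + x * (δ * h))           ≈⟨ +-congˡ (+-cong (*-congʳ (sym (a+[x-a]≈x a x))) (x∙yz≈y∙xz x δ h)) ⟩
    c₀ + ((a + δ) * g + δ * (x * h))     ≈⟨ +-congˡ (+-congʳ (distribʳ g a δ)) ⟩
    c₀ + ((a * g + δ * g) + δ * (x * h)) ≈⟨ +-congˡ (+-assoc _ _ _) ⟩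
    c₀ + (a * g + (δ * g + δ * (x * h))) ≈⟨ +-assoc _ _ _ ⟨
    c₀ + a * g + (δ * g + δ * (x * h))   ≈⟨ +-congˡ (distribˡ δ g (x * h)) ⟨
    c₀ + a * g + δ * (g + x * h)         ∎
    where
    open CommutativeSemigroupProperties *-commutativeSemigroup using (x∙yz≈y∙xz)
    δ = x - a
    g = ⟦ cs ⟧ a
    h = ⟦ quotientAt a cs ⟧ x

  NoZeroDivisors : Set _
  NoZeroDivisors = ∀ {x y} → x ≉ 0# → x * y ≈ 0# → y ≈ 0#

  -- Dividing by `x - a` for the first root `a` lowers the degree by one. Any other listed root
  -- differs from `a` by injectivity, so it remains a root of the quotient.
  rootCount≤degree : 1# ≉ 0# → NoZeroDivisors → ∀ {d m} (cs : Vec Carrier d) (x : Fin m → Carrier) →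
                     Injective _≡_ _≈_ x → (∀ i → ⟦ cs ⟧ (x i) ≈ 0#) → m ≤ d
  rootCount≤degree 1≉0 nzd {m = zero}      cs x x-inj root = z≤n
  rootCount≤degree 1≉0 nzd {zero}  {suc m} [] x x-inj root = contradiction (root zero) 1≉0
  rootCount≤degree 1≉0 nzd {suc d} {suc m} cs x x-inj root =
    s≤s (rootCount≤degree 1≉0 nzd (quotientAt a cs) (x ∘ suc) (Fin.suc-injective ∘ x-inj) root′)
    where
    a = x zero
    root′ : ∀ i → ⟦ quotientAt a cs ⟧ (x (suc i)) ≈ 0#
    root′ i = nzd (λ x≈a → contradiction (x-inj (x∙y⁻¹≈ε⇒x≈y _ _ x≈a)) λ ()) (begin
      δ * q              ≈⟨ +-identityˡ _ ⟨
      0# + δ * q         ≈⟨ +-congʳ (root zero) ⟨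
      ⟦ cs ⟧ a + δ * q   ≈⟨ factorTheorem a cs (x (suc i)) ⟨
      ⟦ cs ⟧ (x (suc i)) ≈⟨ root (suc i) ⟩
      0#                 ∎)
      where
      δ = x (suc i) - a
      q = ⟦ quotientAt a cs ⟧ (x (suc i))

  ⟦replicate-0⟧ : ∀ d x → ⟦ replicate d 0# ⟧ x ≈ x ^ᴿ d
  ⟦replicate-0⟧ zero    x = refl
  ⟦replicate-0⟧ (suc d) x = trans (+-identityˡ _) (*-congˡ (⟦replicate-0⟧ d x))

  fixedByPower-count≤ : 1# ≉ 0# → NoZeroDivisors → ∀ e {m} (x : Fin m → Carrier) →
                        1 < e → Injective _≡_ _≈_ x → (∀ i → x i ^ᴿ e ≈ x i) → m ≤ e
  fixedByPower-count≤ 1≉0 nzd (suc (suc d)) x (s≤s (s≤s _)) x-inj fixed =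
    -- The vector encodes `x ^ e - x` with `e = d + 2`. The bound `1 < e` keeps the coefficient of
    -- `x` apart from the implicit leading one.
    rootCount≤degree 1≉0 nzd (0# ∷ (- 1#) ∷ replicate d 0#) x x-inj root
    where
    root : ∀ i → ⟦ 0# ∷ (- 1#) ∷ replicate d 0# ⟧ (x i) ≈ 0#
    root i = begin
      0# + y * (- 1# + y * ⟦ replicate d 0# ⟧ y) ≈⟨ +-identityˡ _ ⟩
      y * (- 1# + y * ⟦ replicate d 0# ⟧ y)      ≈⟨ *-congˡ (+-congˡ (*-congˡ (⟦replicate-0⟧ d y))) ⟩
      y * (- 1# + y ^ᴿ suc d)                    ≈⟨ distribˡ y _ _ ⟩
      y * - 1# + y ^ᴿ suc (suc d)                ≈⟨ +-cong (trans (*-comm y _) (-1*x≈-x y)) (fixed i) ⟩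
      - y + y                                    ≈⟨ -‿inverseˡ y ⟩
      0#                                         ∎
      where y = x i

-- Finite products

module ProductWithOneException {c ℓ : Level} (S : CommutativeSemiring c ℓ) where
  open CommutativeSemiring S hiding (zero)
  open SemiringExp semiring using () renaming (_^_ to _^ᴿ_)
  open CommutativeMonoidSum *-commutativeMonoid using ()
    renaming (sum to ∏; sum-remove to ∏-remove; sum-cong-≋ to ∏-cong; sum-replicate to ∏-replicate)

  -- The extra `a` in front makes up for the factor 1 at `i₀`, so the exponent is `n` and no
  -- predecessor appears.
  *∏≈^ : ∀ {n} a i₀ (g : Vector Carrier n) → g i₀ ≈ 1# → (∀ i → i ≢ i₀ → g i ≈ a) →
         a * ∏ g ≈ a ^ᴿ n
  *∏≈^ {suc n} a i₀ g gi₀≈1 gi≈a = *-congˡ (begin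
    ∏ g                      ≈⟨ ∏-remove {i = i₀} g ⟩
    g i₀ * ∏ (removeAt g i₀) ≈⟨ *-cong gi₀≈1 (∏-cong (λ i → gi≈a _ (Fin.punchInᵢ≢i i₀ i))) ⟩
    1# * ∏ {n} (λ _ → a)     ≈⟨ *-identityˡ _ ⟩
    ∏ {n} (λ _ → a)          ≈⟨ ∏-replicate n ⟩
    a ^ᴿ n                   ∎)
    where open SetoidReasoning setoid

-- Finite fields: characteristic, Fermat's identity, fixed points of power maps

module FiniteFieldProperties {c ℓ₁ ℓ₂ : Level} {m : ℕ} (E : FiniteField c ℓ₁ ℓ₂ m) where
  open FiniteField E hiding (zero)
  open HeytingField heytingField using (tight; #-irrefl)
  open HeytingProperties (HeytingField.heytingCommutativeRing heytingField) using (1#0; x#0y#0→xy#0)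
  open Inverse enumeration using (to; from; to-cong; strictlyInverseˡ; strictlyInverseʳ)
  open RingProperties ring
    using (x∙y⁻¹≈ε⇒x≈y; x≈y⇒x∙y⁻¹≈ε; x[y-z]≈xy-xz; +-cancelˡ; +-identityˡ-unique)
  open Powers semiring
  open SemiringMult semiring using (×1-homo-*; ×-homo-1) renaming (_×_ to _×ᴿ_)
  open CommutativeMonoidSum +-commutativeMonoid
    using (sum; sum-permute; sum-cong-≋; sum-replicate; ∑-distrib-+)
  open CommutativeMonoidSum *-commutativeMonoid using ()
    renaming (sum to ∏; sum-permute to ∏-permute; sum-cong-≋ to ∏-cong; ∑-distrib-+ to ∏-distrib-*)
  open MonicPolynomial commutativeRing using (NoZeroDivisors; fixedByPower-count≤)
  open ProductWithOneException commutativeSemiring using (*∏≈^)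
  open SetoidReasoning setoid

  1≉0 : 1# ≉ 0#
  1≉0 1≈0 = #-irrefl 1≈0 1#0

  -- A product of two elements apart from 0 is apart from 0. Tightness turns failure of apartness
  -- into equality, and decidable equality removes the double negation.
  noZeroDivisors : NoZeroDivisors
  noZeroDivisors {x} {y} x≉0 xy≈0 = decidable-stable (y ≟ 0#) λ y≉0 →
    x≉0 (proj₁ (tight x 0#) λ x#0 →
    y≉0 (proj₁ (tight y 0#) λ y#0 →
    #-irrefl xy≈0 (x#0y#0→xy#0 x#0 y#0)))

  *-cancelˡ : ∀ {x y z} → x ≉ 0# → x * y ≈ x * z → y ≈ z
  *-cancelˡ {x} {y} {z} x≉0 xy≈xz = x∙y⁻¹≈ε⇒x≈y y z
    (noZeroDivisors x≉0 (trans (x[y-z]≈xy-xz x y z) (x≈y⇒x∙y⁻¹≈ε xy≈xz)))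

  *-cancelʳ : ∀ {x y z} → x ≉ 0# → y * x ≈ z * x → y ≈ z
  *-cancelʳ x≉0 yx≈zx = *-cancelˡ x≉0 (trans (*-comm _ _) (trans yx≈zx (*-comm _ _)))

  ^-≉0 : ∀ {x} → x ≉ 0# → ∀ k → x ^ᴿ k ≉ 0#
  ^-≉0 x≉0 zero    = 1≉0
  ^-≉0 x≉0 (suc k) = ^-≉0 x≉0 k ∘ noZeroDivisors x≉0

  from-injective : Injective _≡_ _≈_ from
  from-injective {i} {j} eq =
    ≡.trans (≡.sym (strictlyInverseˡ i)) (≡.trans (to-cong eq) (strictlyInverseˡ j))

  to-injective : Injective _≈_ _≡_ to
  to-injective {x} {y} eq =
    trans (sym (strictlyInverseʳ x)) (trans (reflexive (cong from eq)) (strictlyInverseʳ y))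

  module _ {f : Carrier → Carrier} (f-cong : Congruent _≈_ _≈_ f) (f-inj : Injective _≈_ _≈_ f) where

    private
      hits : ∀ j → ∃[ i ] to (f (from i)) ≡ j
      hits = Fin-injective⇒surjective (from-injective ∘ f-inj ∘ to-injective)

    injective⇒bijective : Bijective _≈_ _≈_ f
    injective⇒bijective = f-inj , λ y → from (proj₁ (hits (to y))) ,
      λ z≈x → trans (f-cong z≈x) (to-injective (proj₂ (hits (to y))))

    injective⇒permutation : Permutation′ m
    injective⇒permutation = permutation (to ∘ f ∘ from) (proj₁ ∘ hits) (proj₂ ∘ hits)
      (λ i → from-injective (f-inj (to-injective (proj₂ (hits (to (f (from i))))))))

  -- Multiplication by `x` is injective, hence surjective by finiteness, and so hits 1.
  rightInverse : ∀ {x} → x ≉ 0# → ∃[ y ] x * y ≈ 1#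
  rightInverse {x} x≉0 with y , hit ← proj₂ (injective⇒bijective {x *_} *-congˡ (*-cancelˡ x≉0)) 1# =
    y , hit refl

  -- Translation by 1 permutes the field, so it preserves the sum of all elements.
  order×1≈0 : m ×ᴿ 1# ≈ 0#
  order×1≈0 = +-identityˡ-unique (m ×ᴿ 1#) (sum from) (begin
    m ×ᴿ 1# + sum from                  ≈⟨ +-congʳ (sum-replicate m) ⟨
    sum {m} (λ _ → 1#) + sum from       ≈⟨ ∑-distrib-+ (λ _ → 1#) from ⟨
    sum (λ i → 1# + from i)             ≈⟨ sum-cong-≋ {m} (λ _ → strictlyInverseʳ _) ⟨
    sum (λ i → from (to (1# + from i))) ≈⟨ sum-permute from translation ⟨
    sum from                            ∎)
    where
    translation : Permutation′ m
    translation = injective⇒permutation {1# +_} +-congˡ (+-cancelˡ 1# _ _)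

  -- The multiple `m ×ᴿ 1#` is zero and equals the `k`-th power of `p ×ᴿ 1#`; without zero divisors,
  -- the base itself is zero.
  characteristic : ∀ p k → m ≡ p ^ k → p ×ᴿ 1# ≈ 0#
  characteristic p k m≡p^k = cancelPower k (trans (reflexive (cong (_×ᴿ 1#) (≡.sym m≡p^k))) order×1≈0)
    where
    cancelPower : ∀ k → (p ^ k) ×ᴿ 1# ≈ 0# → p ×ᴿ 1# ≈ 0#
    cancelPower zero    1×1≈0 = contradiction (trans (sym (×-homo-1 1#)) 1×1≈0) 1≉0
    cancelPower (suc k) p^1+k×1≈0 = decidable-stable ((p ×ᴿ 1#) ≟ 0#) λ p×1≉0 →
      p×1≉0 (cancelPower k (noZeroDivisors p×1≉0 (trans (sym (×1-homo-* p (p ^ k))) p^1+k×1≈0)))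

  x^order≈x : ∀ x → x ^ᴿ m ≈ x
  x^order≈x x with x ≟ 0#
  -- The index `to x` witnesses that `m` is positive; a zero exponent would give 1 in place of 0.
  ... | yes x≈0 = x≈0⇒x^n≈x (to x)
    where
    x≈0⇒x^n≈x : ∀ {n} → Fin n → x ^ᴿ n ≈ x
    x≈0⇒x^n≈x {suc n} _ = trans (*-congʳ x≈0) (trans (zeroˡ _) (sym x≈0))
  ... | no x≉0 = begin
    x ^ᴿ m                ≈⟨ *∏≈^ x (to 0#) (factor ∘ from) (factor-0 (strictlyInverseʳ 0#))
                               (λ i i≢to0 → factor-≉0 (λ ei≈0 → i≢to0
                                 (≡.trans (≡.sym (strictlyInverseˡ i)) (to-cong ei≈0)))) ⟨
    x * ∏ (factor ∘ from) ≈⟨ *-congˡ ∏factor≈1 ⟩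
    x * 1#                ≈⟨ *-identityʳ x ⟩
    x                     ∎
    where
    -- Multiplication by x permutes the nonzero elements, so it preserves their product;
    -- unit replaces 0 by 1 so that this product can be taken over the whole field.
    unit : Carrier → Carrier
    unit y with y ≟ 0#
    ... | yes _ = 1#
    ... | no  _ = y

    -- The ratio of `unit (x * y)` to `unit y`: equal to `x`, except at 0, where both units are 1.
    factor : Carrier → Carrier
    factor y with y ≟ 0#
    ... | yes _ = 1#
    ... | no  _ = x

    factor-0 : ∀ {y} → y ≈ 0# → factor y ≈ 1#
    factor-0 {y} y≈0 with y ≟ 0#
    ... | yes _   = refl
    ... | no  y≉0 = contradiction y≈0 y≉0

    factor-≉0 : ∀ {y} → y ≉ 0# → factor y ≈ x
    factor-≉0 {y} y≉0 with y ≟ 0#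
    ... | yes y≈0 = contradiction y≈0 y≉0
    ... | no  _   = refl

    unit≉0 : ∀ y → unit y ≉ 0#
    unit≉0 y with y ≟ 0#
    ... | yes _   = 1≉0
    ... | no  y≉0 = y≉0

    unit-scale : ∀ {y z} → z ≈ x * y → unit z ≈ factor y * unit y
    unit-scale {y} {z} z≈xy with y ≟ 0# | z ≟ 0#
    ... | yes _   | yes _   = sym (*-identityˡ 1#)
    ... | yes y≈0 | no  z≉0 = contradiction (trans z≈xy (trans (*-congˡ y≈0) (zeroʳ x))) z≉0
    ... | no  y≉0 | yes z≈0 = contradiction (noZeroDivisors x≉0 (trans (sym z≈xy) z≈0)) y≉0
    ... | no  _   | no  _   = z≈xy

    ∏unit≉0 : ∀ {k} (v : Fin k → Carrier) → ∏ (unit ∘ v) ≉ 0#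
    ∏unit≉0 {zero}  v = 1≉0
    ∏unit≉0 {suc k} v = ∏unit≉0 (v ∘ suc) ∘ noZeroDivisors (unit≉0 (v zero))

    scaling : Permutation′ m
    scaling = injective⇒permutation {x *_} *-congˡ (*-cancelˡ x≉0)

    ∏factor≈1 : ∏ (factor ∘ from) ≈ 1#
    ∏factor≈1 = *-cancelʳ (∏unit≉0 from) (begin
      ∏ (factor ∘ from) * ∏ (unit ∘ from)       ≈⟨ ∏-distrib-* (factor ∘ from) (unit ∘ from) ⟨
      ∏ (λ i → factor (from i) * unit (from i)) ≈⟨ ∏-cong {m} (λ _ → unit-scale (strictlyInverseʳ _)) ⟨
      ∏ (λ i → unit (from (to (x * from i))))   ≈⟨ ∏-permute (unit ∘ from) scaling ⟨
      ∏ (unit ∘ from)                           ≈⟨ *-identityˡ _ ⟨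
      1# * ∏ (unit ∘ from)                      ∎)

  -- If the powers y^(1 + r + ⋯ + r^(k-1)), which are all fixed by the r-th power map, were fixed by
  -- the q-th power map, then y^e ≈ y would hold for every y, with 1 < e < r^k.
  power-fixed-points : ∀ {q r} k .{{_ : NonZero k}} → m ≡ r ^ k → 1 < q → q < r →
                       ¬ (∀ y → y ^ᴿ r ≈ y → y ^ᴿ q ≈ y)
  power-fixed-points {suc q} {r} k m≡r^k (s≤s 0<q) 1+q<r fixed =
    ℕ.<⇒≱ (subst (e <_) (≡.sym m≡r^k) (1+geometricSum*q<r^k k 1+q<r))
      (fixedByPower-count≤ 1≉0 noZeroDivisors e from (s≤s (0<geometricSum*q k)) from-injective
        (λ i → y^e≈y (from i)))
    where
    g = geometricSum r k
    -- Here `q` is the predecessor of the original exponent: for nonzero `y`, that `y ^ g` is fixed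
    -- by the power `suc q` means `y ^ (g * q) = 1`.
    e = suc (g ℕ.* q)

    0<geometricSum*q : ∀ k .{{_ : NonZero k}} → 0 < geometricSum r k ℕ.* q
    0<geometricSum*q (suc k) = ℕ.≤-trans 0<q (ℕ.m≤m+n q _)

    module _ {y} (y≉0 : y ≉ 0#) where
      [y^g]^r≈y^g : (y ^ᴿ g) ^ᴿ r ≈ y ^ᴿ g
      -- An extra factor `y` turns the exponent `g * r` into `r * g + 1 = g + r ^ k`, and `r ^ k` is
      -- the order of the field, so Fermat's identity applies.
      [y^g]^r≈y^g = *-cancelʳ y≉0 (begin
        (y ^ᴿ g) ^ᴿ r * y       ≈⟨ *-cong (^-assocʳ y g r) (sym (*-identityʳ y)) ⟩
        y ^ᴿ (g ℕ.* r) * y ^ᴿ 1 ≈⟨ ^-homo-* y (g ℕ.* r) 1 ⟨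
        y ^ᴿ (g ℕ.* r ℕ.+ 1)    ≡⟨ cong (λ i → y ^ᴿ (i ℕ.+ 1)) (ℕ.*-comm g r) ⟩
        y ^ᴿ (r ℕ.* g ℕ.+ 1)    ≡⟨ cong (y ^ᴿ_) (geometricSum-closed r k) ⟩
        y ^ᴿ (g ℕ.+ r ^ k)      ≡⟨ cong (λ i → y ^ᴿ (g ℕ.+ i)) m≡r^k ⟨
        y ^ᴿ (g ℕ.+ m)          ≈⟨ ^-homo-* y g m ⟩
        y ^ᴿ g * y ^ᴿ m         ≈⟨ *-congˡ (x^order≈x y) ⟩
        y ^ᴿ g * y              ∎)

      y^[g*q]≈1 : y ^ᴿ (g ℕ.* q) ≈ 1#
      y^[g*q]≈1 = *-cancelˡ (^-≉0 y≉0 g) (begin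
        y ^ᴿ g * y ^ᴿ (g ℕ.* q) ≈⟨ ^-homo-* y g (g ℕ.* q) ⟨
        y ^ᴿ (g ℕ.+ g ℕ.* q)    ≡⟨ cong (y ^ᴿ_) (ℕ.*-suc g q) ⟨
        y ^ᴿ (g ℕ.* suc q)      ≈⟨ ^-assocʳ y g (suc q) ⟨
        (y ^ᴿ g) ^ᴿ suc q       ≈⟨ fixed (y ^ᴿ g) [y^g]^r≈y^g ⟩
        y ^ᴿ g                  ≈⟨ *-identityʳ _ ⟨
        y ^ᴿ g * 1#             ∎)

    y^e≈y : ∀ y → y ^ᴿ e ≈ y
    y^e≈y y with y ≟ 0#
    ... | yes y≈0 = trans (*-congʳ y≈0) (trans (zeroˡ _) (sym y≈0))
    ... | no  y≉0 = trans (*-congˡ (y^[g*q]≈1 y≉0)) (*-identityʳ y)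

-- Additivity and semilinearity of q-polynomials

module QPolynomialProperties
  {c ℓ₁ ℓ₂ : Level} (q n : ℕ) (E : FiniteField c ℓ₁ ℓ₂ (q ^ n))
  (b : Vector (FiniteField.Carrier E) n)
  where

  open FiniteField E hiding (zero)
  open FiniteFieldProperties E
  open RingProperties ring using (+-identityˡ-unique; x∙y⁻¹≈ε⇒x≈y; //-rightDividesˡ)
  open CommutativeSemigroupProperties *-commutativeSemigroup using (x∙yz≈y∙xz)
  open CommutativeSemiringExp commutativeSemiring using (^-congˡ; ^-distrib-*)
  open FrobeniusMap commutativeSemiring using (^-primePower-distrib-+)
  open SemiringExp semiring using () renaming (_^_ to _^ᴿ_)
  open SemiringSum semiring using (sum; sum-cong-≋; ∑-distrib-+; *-distribˡ-sum)
  open Powers semiring using (periodic)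
  open QPolynomial q n E b
  open SetoidReasoning setoid

  eval-cong : Congruent _≈_ _≈_ eval
  eval-cong x≈y = sum-cong-≋ {n} (λ i → *-congˡ (^-congˡ (q ^ toℕ i) x≈y))

  eval-+ : IsPrimePower q → ∀ x y → eval (x + y) ≈ eval x + eval y
  eval-+ (p , k , pr , _ , q≡p^k) x y = begin
    eval (x + y)                                                ≈⟨ sum-cong-≋ {n} term-+ ⟩
    sum (λ i → b i * x ^ᴿ (q ^ toℕ i) + b i * y ^ᴿ (q ^ toℕ i)) ≈⟨ ∑-distrib-+ {n} _ _ ⟩
    eval x + eval y                                             ∎
    where
    q^[_] : ∀ i → q ^ i ≡ p ^ (k ℕ.* i)
    q^[ i ] = ≡.trans (cong (_^ i) q≡p^k) (ℕ.^-*-assoc p k i)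

    term-+ : ∀ i → b i * (x + y) ^ᴿ (q ^ toℕ i) ≈ b i * x ^ᴿ (q ^ toℕ i) + b i * y ^ᴿ (q ^ toℕ i)
    term-+ i = trans (*-congˡ frobenius) (distribˡ (b i) _ _)
      where
      frobenius : (x + y) ^ᴿ (q ^ toℕ i) ≈ x ^ᴿ (q ^ toℕ i) + y ^ᴿ (q ^ toℕ i)
      frobenius rewrite q^[ toℕ i ] =
        -- The field has `q ^ n = p ^ (k * n)` elements, hence characteristic `p`, and `q ^ toℕ i`
        -- is a power of `p` too.
        ^-primePower-distrib-+ pr (characteristic p (k ℕ.* n) q^[ n ]) (k ℕ.* toℕ i) x y

  -- Additivity is applied to `(x - y) + y`, so that compatibility of `eval` with negation need not
  -- be shown separately.
  zeroKernel⇒injective : IsPrimePower q → (∀ x → eval x ≈ 0# → x ≈ 0#) → Injective _≈_ _≈_ eval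
  zeroKernel⇒injective q-pp ker {x} {y} hx≈hy = x∙y⁻¹≈ε⇒x≈y x y (ker (x - y)
    (+-identityˡ-unique (eval (x - y)) (eval y) (begin
      eval (x - y) + eval y ≈⟨ eval-+ q-pp (x - y) y ⟨
      eval (x - y + y)      ≈⟨ eval-cong (//-rightDividesˡ y x) ⟩
      eval x                ≈⟨ hx≈hy ⟩
      eval y                ∎)))

  t∣n : t ∣ n
  t∣n = foldr-gcd∣ {xs = Δ} (here ≡.refl)

  -- Without zero divisors `b i * b j` is nonzero, so the difference of the exponents modulo `n` is
  -- listed in `Δ`. Their gcd `t` divides it, and divides `n` as well.
  exponents-congruent : ∀ {i j} → b i ≉ 0# → b j ≉ 0# → i ≢ j →
    (∃[ k ] toℕ i ≡ k ℕ.* t ℕ.+ toℕ j) ⊎ (∃[ k ] toℕ j ≡ k ℕ.* t ℕ.+ toℕ i)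
  exponents-congruent {i} {j} bi≉0 bj≉0 i≢j =
    ∣%ℕ⇒congruent (toℕ i) (toℕ j) n {{Fin.nonZeroIndex i}} t∣n
      (foldr-gcd∣ {xs = Δ} (there (∈-map⁺ differenceMod (∈-filter⁺ contributesToΔ?
        (∈-cartesianProduct⁺ (∈-allFin i) (∈-allFin j))
        (bj≉0 ∘ noZeroDivisors bi≉0 , i≢j)))))

  eval-semilinear : ∀ {a} → a ^ᴿ (q ^ t) ≈ a → ∃[ μ ] (∀ x → eval (a * x) ≈ μ * eval x)
  eval-semilinear {a} a-fixed with Fin.any? (λ i → ¬? (b i ≟ 0#))
  -- The zero polynomial offers no exponent to choose, and any multiplier would do.
  ... | no all≈0 = 1# , λ x → trans (sum-cong-≋ {n} (λ i → *-both-0 (vanish i))) (sym (*-identityˡ _))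
    where
    vanish : ∀ i → b i ≈ 0#
    vanish i = decidable-stable (b i ≟ 0#) (λ bi≉0 → all≈0 (i , bi≉0))
    *-both-0 : ∀ {z x y} → z ≈ 0# → z * x ≈ z * y
    *-both-0 z≈0 = trans (*-congʳ z≈0) (trans (zeroˡ _) (sym (trans (*-congʳ z≈0) (zeroˡ _))))
  ... | yes (j , bj≉0) = μ , λ x → begin
    eval (a * x)                             ≈⟨ sum-cong-≋ {n} (term x) ⟩
    sum (λ i → μ * (b i * x ^ᴿ (q ^ toℕ i))) ≈⟨ *-distribˡ-sum {n} μ _ ⟨
    μ * eval x                               ∎
    where
    -- Any exponent in the support gives the same multiplier, since all of them agree modulo `t`.
    μ = a ^ᴿ (q ^ toℕ j)

    a^qⁱ≈μ : ∀ i → b i ≉ 0# → a ^ᴿ (q ^ toℕ i) ≈ μ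
    a^qⁱ≈μ i bi≉0 with i Fin.≟ j
    ... | yes ≡.refl = refl
    ... | no  i≢j with exponents-congruent bi≉0 bj≉0 i≢j
    ...   | inj₁ (k , eq) rewrite eq = periodic q t k (toℕ j) a-fixed
    ...   | inj₂ (k , eq) =
      sym (trans (reflexive (cong (λ e → a ^ᴿ (q ^ e)) eq)) (periodic q t k (toℕ i) a-fixed))

    term : ∀ x i → b i * (a * x) ^ᴿ (q ^ toℕ i) ≈ μ * (b i * x ^ᴿ (q ^ toℕ i))
    term x i with b i ≟ 0#
    ... | yes bi≈0 = trans (trans (*-congʳ bi≈0) (zeroˡ _))
      (sym (trans (*-congˡ (trans (*-congʳ bi≈0) (zeroˡ _))) (zeroʳ μ)))
    ... | no  bi≉0 = begin
      b i * (a * x) ^ᴿ (q ^ toℕ i)                ≈⟨ *-congˡ (^-distrib-* a x (q ^ toℕ i)) ⟩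
      b i * (a ^ᴿ (q ^ toℕ i) * x ^ᴿ (q ^ toℕ i)) ≈⟨ *-congˡ (*-congʳ (a^qⁱ≈μ i bi≉0)) ⟩
      b i * (μ * x ^ᴿ (q ^ toℕ i))                ≈⟨ x∙yz≈y∙xz (b i) μ _ ⟩
      μ * (b i * x ^ᴿ (q ^ toℕ i))                ∎

-- The subfield F and the kernel of a scattered polynomial

module ExtensionProperties
  {c ℓ₁ ℓ₂ c′ ℓ₁′ ℓ₂′ : Level} (q n : ℕ)
  (F : FiniteField c ℓ₁ ℓ₂ q) (E : FiniteField c′ ℓ₁′ ℓ₂′ (q ^ n))
  (ι : RingHomomorphism (FiniteField.rawRing F) (FiniteField.rawRing E))
  where

  private
    module F where
      open FiniteField F public
      open FiniteFieldProperties F public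
      open SemiringExp (FiniteField.semiring F) public using () renaming (_^_ to _^ᴿ_)
  open FiniteField E hiding (zero)
  open FiniteFieldProperties E
  open RingProperties ring using (+-inverseʳ-unique; x≈y⇒x∙y⁻¹≈ε)
  open CommutativeSemiringExp commutativeSemiring using (^-congˡ; ^-distrib-*)
  open SemiringExp semiring using () renaming (_^_ to _^ᴿ_)
  open RingHomomorphism ι using (⟦_⟧; ⟦⟧-cong; *-homo; 1#-homo; -‿homo)
  open Extension q n F E ι using (LinearlyDependent; IsScattered)
  open SetoidReasoning setoid

  ⟦⟧-^-homo : ∀ α k → ⟦ α F.^ᴿ k ⟧ ≈ ⟦ α ⟧ ^ᴿ k
  ⟦⟧-^-homo α zero    = 1#-homo
  ⟦⟧-^-homo α (suc k) = trans (*-homo α _) (*-congˡ (⟦⟧-^-homo α k))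

  ⟦⟧^q≈⟦⟧ : ∀ α → ⟦ α ⟧ ^ᴿ q ≈ ⟦ α ⟧
  ⟦⟧^q≈⟦⟧ α = trans (sym (⟦⟧-^-homo α q)) (⟦⟧-cong (F.x^order≈x α))

  -- An inverse of a nonzero `α` in the kernel would give 1 = 0 in the larger field.
  ⟦⟧≈0⇒≈0 : ∀ {α} → ⟦ α ⟧ ≈ 0# → α F.≈ F.0#
  ⟦⟧≈0⇒≈0 {α} ⟦α⟧≈0 = decidable-stable (α F.≟ F.0#) λ α≉0 →
    let γ , αγ≈1 = F.rightInverse α≉0 in 1≉0 (begin
      1#            ≈⟨ 1#-homo ⟨
      ⟦ F.1# ⟧      ≈⟨ ⟦⟧-cong αγ≈1 ⟨
      ⟦ α F.* γ ⟧   ≈⟨ *-homo α γ ⟩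
      ⟦ α ⟧ * ⟦ γ ⟧ ≈⟨ *-congʳ ⟦α⟧≈0 ⟩
      0# * ⟦ γ ⟧    ≈⟨ zeroˡ _ ⟩
      0#            ∎)

  -- Cancelling `x` exhibits `a` as the ratio of the images of `- α` and `β`, both fixed by the
  -- `q`-th power map. Membership of `a` in F is thus expressed as being fixed by that map.
  dependentMultiple⇒^q-fixed : ∀ {a x} → x ≉ 0# → LinearlyDependent x (a * x) → a ^ᴿ q ≈ a
  dependentMultiple⇒^q-fixed {a} {x} x≉0 (α , β , αβ≉0 , αx+βax≈0) = *-cancelˡ ⟦β⟧≉0 (begin
    ⟦ β ⟧ * a ^ᴿ q      ≈⟨ *-congʳ (⟦⟧^q≈⟦⟧ β) ⟨
    ⟦ β ⟧ ^ᴿ q * a ^ᴿ q ≈⟨ ^-distrib-* ⟦ β ⟧ a q ⟨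
    (⟦ β ⟧ * a) ^ᴿ q    ≈⟨ ^-congˡ q βa≈-α ⟩
    ⟦ F.- α ⟧ ^ᴿ q      ≈⟨ ⟦⟧^q≈⟦⟧ (F.- α) ⟩
    ⟦ F.- α ⟧           ≈⟨ βa≈-α ⟨
    ⟦ β ⟧ * a           ∎)
    where
    α+βa≈0 : ⟦ α ⟧ + ⟦ β ⟧ * a ≈ 0#
    α+βa≈0 = noZeroDivisors x≉0 (begin
      x * (⟦ α ⟧ + ⟦ β ⟧ * a)     ≈⟨ *-comm x _ ⟩
      (⟦ α ⟧ + ⟦ β ⟧ * a) * x     ≈⟨ distribʳ x _ _ ⟩
      ⟦ α ⟧ * x + ⟦ β ⟧ * a * x   ≈⟨ +-congˡ (*-assoc _ a x) ⟩
      ⟦ α ⟧ * x + ⟦ β ⟧ * (a * x) ≈⟨ αx+βax≈0 ⟩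
      0#                          ∎)

    βa≈-α : ⟦ β ⟧ * a ≈ ⟦ F.- α ⟧
    βa≈-α = trans (+-inverseʳ-unique _ _ α+βa≈0) (sym (-‿homo α))

    ⟦β⟧≉0 : ⟦ β ⟧ ≉ 0#
    -- If `β` vanished, the relation would force `α` to vanish too, against nontriviality.
    ⟦β⟧≉0 ⟦β⟧≈0 = αβ≉0 (⟦⟧≈0⇒≈0 ⟦α⟧≈0 , ⟦⟧≈0⇒≈0 ⟦β⟧≈0)
      where
      ⟦α⟧≈0 : ⟦ α ⟧ ≈ 0#
      ⟦α⟧≈0 = begin
        ⟦ α ⟧             ≈⟨ +-identityʳ _ ⟨
        ⟦ α ⟧ + 0#        ≈⟨ +-congˡ (trans (*-congʳ ⟦β⟧≈0) (zeroˡ a)) ⟨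
        ⟦ α ⟧ + ⟦ β ⟧ * a ≈⟨ α+βa≈0 ⟩
        0#                ∎

  scattered⇒zeroKernel : ∀ b → let open QPolynomial q n E b in 1 < q → 1 < n →
                         IsScattered b → InStandardForm → ∀ x → eval x ≈ 0# → x ≈ 0#
  scattered⇒zeroKernel b 1<q 1<n scattered 1<t x hx≈0 = decidable-stable (x ≟ 0#) λ x≉0 →
    -- Taken with `r = q ^ t` and `k = n / t`: not every fixed point of the `q ^ t`-th power map is
    -- fixed by the `q`-th one.
    power-fixed-points k q^n≡[q^t]^k 1<q q<q^t λ a a-fixed →
      dependentMultiple⇒^q-fixed x≉0 (scattered x (a * x) (kernel-pair (h[ax]≈0 a-fixed)))
    where
    open QPolynomial q n E b
    open QPolynomialProperties q n E b using (t∣n; eval-semilinear)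

    k = quotient t∣n

    instance
      k≢0 : NonZero k
      k≢0 = quotient≢0 t∣n {{>-nonZero (ℕ.<-trans (s≤s z≤n) 1<n)}}

    q^n≡[q^t]^k : q ^ n ≡ (q ^ t) ^ k
    q^n≡[q^t]^k = ≡.trans (cong (q ^_) (m∣n⇒n≡m*quotient t∣n)) (≡.sym (ℕ.^-*-assoc q t k))

    q<q^t : q < q ^ t
    q<q^t = subst (_< q ^ t) (ℕ.^-identityʳ q) (ℕ.^-monoʳ-< q 1<q 1<t)

    h[ax]≈0 : ∀ {a} → a ^ᴿ (q ^ t) ≈ a → eval (a * x) ≈ 0#
    h[ax]≈0 a-fixed with μ , h[ax]≈μhx ← eval-semilinear a-fixed =
      trans (h[ax]≈μhx x) (trans (*-congˡ hx≈0) (zeroʳ μ))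

    kernel-pair : ∀ {z} → eval z ≈ 0# → z * eval x - x * eval z ≈ 0#
    kernel-pair {z} hz≈0 = x≈y⇒x∙y⁻¹≈ε (begin
      z * eval x ≈⟨ *-congˡ hx≈0 ⟩
      z * 0#     ≈⟨ zeroʳ z ⟩
      0#         ≈⟨ zeroʳ x ⟨
      x * 0#     ≈⟨ *-congˡ hz≈0 ⟨
      x * eval z ∎)

primePower>1 : ∀ {q} → IsPrimePower q → 1 < q
primePower>1 (p , k , pr , 1≤k , ≡.refl) =
  ℕ.^-monoʳ-< p (nonTrivial⇒n>1 p {{prime⇒nonTrivial pr}}) 1≤k

theorem4p5 : {c ℓ₁ ℓ₂ c′ ℓ₁′ ℓ₂′ : Level} (q n : ℕ) → IsPrimePower q → 1 < n →
    (F : FiniteField c ℓ₁ ℓ₂ q) (E : FiniteField c′ ℓ₁′ ℓ₂′ (q ^ n))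
    (ι : RingHomomorphism (FiniteField.rawRing F) (FiniteField.rawRing E))
    (h : Vector (FiniteField.Carrier E) n) →
    Extension.IsScattered q n F E ι h →
    QPolynomial.InStandardForm q n E h →
    Bijective (FiniteField._≈_ E) (FiniteField._≈_ E) (QPolynomial.eval q n E h)
theorem4p5 q n q-pp 1<n F E ι h scattered standard =
  injective⇒bijective eval-cong (zeroKernel⇒injective q-pp
    (scattered⇒zeroKernel h (primePower>1 q-pp) 1<n scattered standard))
  where
  open FiniteFieldProperties E using (injective⇒bijective)
  open QPolynomialProperties q n E h using (eval-cong; zeroKernel⇒injective)
  open ExtensionProperties q n F E ι using (scattered⇒zeroKernel)
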